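{- Let $n_1\ge n_2\ge n_3\ge 1$ be integers. Then $\mathrm{ex}(K_{n_1,n_2,n_3}, \{C_3, C_4^{\text{multi}}\})=n_1n_2+n_3$, i.e. the maximum number of edges of a subgraph of $K_{n_1,n_2,n_3}$ that contains neither a triangle nor a $C_4^{\text{multi}}$ equals $n_1n_2+n_3$.
   Context: $K_{n_1,n_2,n_3}$ denotes the complete $3$-partite graph with parts $V_1,V_2,V_3$ of sizes $n_1,n_2,n_3$. $C_4^{\text{multi}}$ denotes a multipartite $4$-cycle, i.e. a cycle of length $4$ in the $3$-partite graph containing at least one vertex in each of the three parts. $\mathrm{ex}(G,\mathcal{F})$ is the maximum number of edges of a subgraph $H\subseteq G$ containing no member of $\mathcal{F}$ as a subgraph. -}

module Defs where

open import Data.Nat using (ℕ; _+_; _*_; _≤_; _<ᵇ_)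
open import Data.Fin using (Fin; toℕ; splitAt)
open import Data.Bool using (Bool; true; false; _∧_)
open import Data.Sum using (inj₁; inj₂; _⊎_)
open import Data.Product using (Σ; _×_; _,_; ∃-syntax)
open import Data.List using (List; allFin; cartesianProduct; filterᵇ; length)
open import Relation.Binary.PropositionalEquality using (_≡_; _≢_)
open import Relation.Nullary using (¬_)

-- The complete 3-partite graph K_{n1,n2,n3}: vertex set Fin (n1 + (n2 + n3)),
-- the first n1 vertices form V_1 (part 0), the next n2 form V_2 (part 1),
-- the last n3 form V_3 (part 2); two vertices are adjacent iff in different parts.
Vtx : ℕ → ℕ → ℕ → Set
Vtx n₁ n₂ n₃ = Fin (n₁ + (n₂ + n₃))

part : ∀ n₁ n₂ n₃ → Vtx n₁ n₂ n₃ → Fin 3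
part n₁ n₂ n₃ v with splitAt n₁ v
... | inj₁ _ = Fin.zero
... | inj₂ w with splitAt n₂ w
...   | inj₁ _ = Fin.suc Fin.zero
...   | inj₂ _ = Fin.suc (Fin.suc Fin.zero)

record Subgraph (n₁ n₂ n₃ : ℕ) : Set where
  field
    adj   : Vtx n₁ n₂ n₃ → Vtx n₁ n₂ n₃ → Bool
    sym   : ∀ u v → adj u v ≡ adj v u
    cross : ∀ u v → adj u v ≡ true → part n₁ n₂ n₃ u ≢ part n₁ n₂ n₃ v
open Subgraph public

edgeCount : ∀ {n₁ n₂ n₃} → Subgraph n₁ n₂ n₃ → ℕ
edgeCount {n₁} {n₂} {n₃} H =
  length (filterᵇ (λ { (u , v) → (toℕ u <ᵇ toℕ v) ∧ adj H u v })
                  (cartesianProduct (allFin (n₁ + (n₂ + n₃))) (allFin (n₁ + (n₂ + n₃)))))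

-- H contains a triangle C_3 (vertices are automatically distinct since H is loopless)
HasTriangle : ∀ {n₁ n₂ n₃} → Subgraph n₁ n₂ n₃ → Set
HasTriangle H = ∃[ u ] ∃[ v ] ∃[ w ]
  (adj H u v ≡ true × adj H v w ≡ true × adj H w u ≡ true)

HasMultiC4 : ∀ {n₁ n₂ n₃} → Subgraph n₁ n₂ n₃ → Set
HasMultiC4 {n₁} {n₂} {n₃} H = ∃[ a ] ∃[ b ] ∃[ c ] ∃[ d ]
  ( (a ≢ b × a ≢ c × a ≢ d × b ≢ c × b ≢ d × c ≢ d)
  × (adj H a b ≡ true × adj H b c ≡ true × adj H c d ≡ true × adj H d a ≡ true)
  × (∀ (i : Fin 3) → part n₁ n₂ n₃ a ≡ i ⊎ part n₁ n₂ n₃ b ≡ i ⊎ part n₁ n₂ n₃ c ≡ i ⊎ part n₁ n₂ n₃ d ≡ i))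

Free : ∀ {n₁ n₂ n₃} → Subgraph n₁ n₂ n₃ → Set
Free H = ¬ HasTriangle H × ¬ HasMultiC4 H

ExEquals : ℕ → ℕ → ℕ → ℕ → Set
ExEquals n₁ n₂ n₃ m =
  (∀ (H : Subgraph n₁ n₂ n₃) → Free H → edgeCount H ≤ m)
  × (Σ (Subgraph n₁ n₂ n₃) λ H → (Free {n₁} {n₂} {n₃} H × edgeCount H ≡ m))

{-# OPTIONS --safe #-}
module Submission where

-- Write b_a, c_a for the numbers of neighbours of a ∈ A in B and in C, and similarly for the other
-- parts.  The rectangles N_B(a) × N_C(a) contain no edge (no triangle) and are pairwise disjoint
-- (no multipartite 4-cycle), so Σ_a b_a c_a + e(B,C) ≤ n₂ n₃, and likewise for B and C.
--
-- If n₃ < n₁ and n₃ ≤ n₂, some a has degree at most n₂, since otherwise b_a c_a ≥ n₂ for all a.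
-- Deleting such vertices from A, and symmetrically from B, leaves the case n₁ = n₂ = n₃ = N, where
-- the bound is N² + N.  By induction on N we may delete a vertex of degree ≤ 1, two vertices of
-- different parts meeting ≤ N + 1 edges, or three meeting ≤ 2N edges.
--
-- If all vertices of some part have neighbours in both other parts, b_a c_a ≥ b_a + c_a − 1 gives
-- the bound.  So let c have neighbours only in A, say, and let a ~ c.
-- If a has a neighbour in B, then N_B(a) contains a b such that {b, c} or {a, b, c} can be deleted.
-- Otherwise this argument also applies to the neighbours of c and of a, and shows that none of them
-- has a neighbour in B; then {a, b, c} can be deleted for any b with neighbours in one part only.

open import Defs hiding (sym)
open import Data.Bool as Bool using (Bool; true; false; _∧_; not; T)
open import Data.Bool.Properties using (not-¬; not-involutive)
open import Data.Fin using (Fin; zero; suc; fromℕ<; punchIn; toℕ; splitAt; _↑ˡ_; _↑ʳ_)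
import Data.Fin.Properties as Fin
open import Data.Fin.Properties using (any?; punchIn-injective; toℕ-injective; toℕ<n; toℕ-↑ˡ; toℕ-↑ʳ; ↑ˡ-injective; ↑ʳ-injective; splitAt-↑ˡ; splitAt-↑ʳ; splitAt⁻¹-↑ˡ; splitAt⁻¹-↑ʳ)
open import Data.List as List using (_++_; tabulate; cartesianProduct; filterᵇ; length)
open import Data.List.Properties using (map-tabulate; length-++; filter-++)
open import Data.Nat using (ℕ; zero; suc; _+_; _*_; _∸_; _≤_; _<_; _≥_; _≤?_; _<ᵇ_; _≡ᵇ_; z≤n; s≤s; s≤s⁻¹; >-nonZero)
open import Data.Nat.Properties
open import Data.Nat.Tactic.RingSolver using (solve-∀)
open import Data.Product using (_×_; _,_; ∃-syntax; proj₁; proj₂)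
open import Data.Sum as Sum using (_⊎_; inj₁; inj₂)
open import Function using (_∘_; flip; id)
open import Relation.Binary.PropositionalEquality using (_≡_; _≢_; refl; sym; trans; cong; cong₂; subst; module ≡-Reasoning)
open import Relation.Nullary using (¬_; yes; no; contradiction)
open import Relation.Nullary.Decidable using (_×-dec_; _⊎-dec_; T?)
open import Algebra.Properties.Semiring.Sum +-*-semiring using (sum; sum-cong-≗; sum-remove; sum-replicate-zero; ∑-distrib-+; ∑-comm; *-distribˡ-sum; *-distribʳ-sum)

-- Indicators and finite sums.

𝟙 : Bool → ℕ
𝟙 true  = 1
𝟙 false = 0

𝟙≤1 : ∀ x → 𝟙 x ≤ 1
𝟙≤1 true  = s≤s z≤n
𝟙≤1 false = z≤n

𝟙-∧ : ∀ x y → 𝟙 (x ∧ y) ≡ 𝟙 x * 𝟙 y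
𝟙-∧ true  y = sym (+-identityʳ (𝟙 y))
𝟙-∧ false y = refl

∧-true : ∀ {x y} → x ∧ y ≡ true → x ≡ true × y ≡ true
∧-true {true} {true} _ = refl , refl

sum-mono : ∀ {n} {f g : Fin n → ℕ} → (∀ i → f i ≤ g i) → sum f ≤ sum g
sum-mono {zero}  f≤g = z≤n
sum-mono {suc n} f≤g = +-mono-≤ (f≤g zero) (sum-mono (f≤g ∘ suc))

sum-const : ∀ n k → sum {n} (λ _ → k) ≡ n * k
sum-const zero    k = refl
sum-const (suc n) k = cong (k +_) (sum-const n k)

sum-≤-const : ∀ {n} {f : Fin n → ℕ} k → (∀ i → f i ≤ k) → sum f ≤ n * k
sum-≤-const {n} k f≤k = ≤-trans (sum-mono f≤k) (≤-reflexive (sum-const n k))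

sum-≥-const : ∀ {n} {f : Fin n → ℕ} k → (∀ i → k ≤ f i) → n * k ≤ sum f
sum-≥-const {n} k k≤f = ≤-trans (≤-reflexive (sym (sum-const n k))) (sum-mono k≤f)

sum-+-≤ : ∀ {n} (f g : Fin n → ℕ) k → (∀ i → f i + g i ≤ k) → sum f + sum g ≤ n * k
sum-+-≤ f g k f+g≤k = ≤-trans (≤-reflexive (sym (∑-distrib-+ f g))) (sum-≤-const k f+g≤k)

sum-product : ∀ {m n} (f : Fin m → ℕ) (g : Fin n → ℕ) →
  sum f * sum g ≡ sum (λ i → sum (λ j → f i * g j))
sum-product f g = trans (*-distribʳ-sum (sum g) f) (sum-cong-≗ (λ i → *-distribˡ-sum (f i) g))

sum-𝟙-≤ : ∀ {n} (P : Fin n → Bool) → sum (𝟙 ∘ P) ≤ n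
sum-𝟙-≤ {n} P = ≤-trans (sum-≤-const 1 (𝟙≤1 ∘ P)) (≤-reflexive (*-identityʳ n))

sum-𝟙-none : ∀ {n} (P : Fin n → Bool) → (∀ i → P i ≢ true) → sum (𝟙 ∘ P) ≡ 0
sum-𝟙-none {zero}  P none = refl
sum-𝟙-none {suc n} P none with P zero in eq
... | true  = contradiction eq (none zero)
... | false = sum-𝟙-none (P ∘ suc) (none ∘ suc)

sum-𝟙-unique : ∀ {n} (P : Fin n → Bool) → (∀ i j → P i ≡ true → P j ≡ true → i ≡ j) →
  sum (𝟙 ∘ P) ≤ 1
sum-𝟙-unique {zero}  P unique = z≤n
sum-𝟙-unique {suc n} P unique with P zero in eq
... | true  = ≤-reflexive (cong suc (sum-𝟙-none (P ∘ suc) λ i Pi → contradiction (unique zero (suc i) eq Pi) λ ()))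
... | false = sum-𝟙-unique (P ∘ suc) λ i j Pi Pj → Fin.suc-injective (unique (suc i) (suc j) Pi Pj)

-- Meant for two vertices of different parts: `P` marks their common neighbours in the third part,
-- `r` their adjacency. Two common neighbours give a multipartite 4-cycle, one together with
-- adjacency a triangle.
sum-𝟙-unique-or : ∀ {n} (P : Fin n → Bool) r → (∀ i j → P i ≡ true → P j ≡ true → i ≡ j) →
  (r ≡ true → ∀ i → P i ≢ true) → sum (𝟙 ∘ P) + 𝟙 r ≤ 1
sum-𝟙-unique-or P true  unique excl = ≤-reflexive (cong (_+ 1) (sum-𝟙-none P (excl refl)))
sum-𝟙-unique-or P false unique excl = ≤-trans (≤-reflexive (+-identityʳ _)) (sum-𝟙-unique P unique)

sum-𝟙-zero : ∀ {n} (P : Fin n → Bool) → sum (𝟙 ∘ P) ≡ 0 → ∀ i → P i ≢ true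
sum-𝟙-zero {suc n} P sum≡0 i Pi = contradiction
  (≤-trans (≤-reflexive (cong 𝟙 (sym Pi))) (≤-trans (m≤m+n _ _) (≤-reflexive (trans (sym (sum-remove {i = i} (𝟙 ∘ P))) sum≡0))))
  λ ()

𝟙-exclusive : ∀ x y → (y ≡ true → x ≢ true) → 𝟙 x + 𝟙 y ≤ 1
𝟙-exclusive true  true  excl = contradiction refl (excl refl)
𝟙-exclusive true  false excl = ≤-refl
𝟙-exclusive false y     excl = 𝟙≤1 y

𝟙-inclusion-exclusion : ∀ x y → 𝟙 x + 𝟙 y ≤ 1 + 𝟙 (x ∧ y)
𝟙-inclusion-exclusion true  y = ≤-refl
𝟙-inclusion-exclusion false y = 𝟙≤1 y

sum-vanish : ∀ {n} {f : Fin n → ℕ} → (∀ i → f i ≡ 0) → sum f ≡ 0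
sum-vanish {n} f≡0 = trans (sum-cong-≗ f≡0) (sum-replicate-zero n)

sum-split : ∀ m {k} (f : Fin (m + k) → ℕ) → sum f ≡ sum (λ i → f (i ↑ˡ k)) + sum (λ j → f (m ↑ʳ j))
sum-split zero    f = refl
sum-split (suc m) f = trans (cong (f zero +_) (sum-split m (f ∘ suc))) (sym (+-assoc (f zero) _ _))

-- Counts the edges between A and C in the extremal graph, where only the first vertex of A
-- contributes.
sum-zero-indicator : ∀ {n} k → 1 ≤ n → sum {n} (λ a → sum {k} λ _ → 𝟙 (toℕ a ≡ᵇ 0)) ≡ k
sum-zero-indicator {suc n} k _ = trans (cong₂ _+_ (trans (sum-const k 1) (*-identityʳ k))
  (sum-vanish {n} λ _ → sum-replicate-zero k)) (+-identityʳ k)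

-- Tripartite graphs, exchange of parts, deletion of vertices.

-- A multipartite 4-cycle consists of two vertices of one part with a common neighbour in each of
-- the other two parts; the fields unique-a, unique-b and unique-c exclude it.
record Graph (n₁ n₂ n₃ : ℕ) : Set where
  field
    ab : Fin n₁ → Fin n₂ → Bool
    ac : Fin n₁ → Fin n₃ → Bool
    bc : Fin n₂ → Fin n₃ → Bool
    no-triangle : ∀ {a b c} → ab a b ≡ true → ac a c ≡ true → bc b c ≢ true
    unique-a : ∀ {b c a a′} → ab a b ≡ true → ac a c ≡ true → ab a′ b ≡ true → ac a′ c ≡ true → a ≡ a′
    unique-b : ∀ {a c b b′} → ab a b ≡ true → bc b c ≡ true → ab a b′ ≡ true → bc b′ c ≡ true → b ≡ b′
    unique-c : ∀ {a b c c′} → ac a c ≡ true → bc b c ≡ true → ac a c′ ≡ true → bc b c′ ≡ true → c ≡ c′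

  A→B : Fin n₁ → ℕ
  A→B a = sum (λ b → 𝟙 (ab a b))

  A→C : Fin n₁ → ℕ
  A→C a = sum (λ c → 𝟙 (ac a c))

  B→A : Fin n₂ → ℕ
  B→A b = sum (λ a → 𝟙 (ab a b))

  B→C : Fin n₂ → ℕ
  B→C b = sum (λ c → 𝟙 (bc b c))

  C→A : Fin n₃ → ℕ
  C→A c = sum (λ a → 𝟙 (ac a c))

  C→B : Fin n₃ → ℕ
  C→B c = sum (λ b → 𝟙 (bc b c))

  edges : ℕ
  edges = sum A→B + sum A→C + sum B→C

open Graph

A→B≤ : ∀ {n₁ n₂ n₃} (G : Graph n₁ n₂ n₃) a → A→B G a ≤ n₂
A→B≤ G a = sum-𝟙-≤ (ab G a)

A→C≤ : ∀ {n₁ n₂ n₃} (G : Graph n₁ n₂ n₃) a → A→C G a ≤ n₃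
A→C≤ G a = sum-𝟙-≤ (ac G a)

Bound : ℕ → ℕ → ℕ → ℕ → Set
Bound n₁ n₂ n₃ m = (G : Graph n₁ n₂ n₃) → edges G ≤ m

-- `swapAB` and `swapAC` generate all permutations of the parts, so the counting lemmas are needed
-- in one arrangement only.
swapAB : ∀ {n₁ n₂ n₃} → Graph n₁ n₂ n₃ → Graph n₂ n₁ n₃
swapAB G = record
  { ab = flip (ab G) ; ac = bc G ; bc = ac G
  ; no-triangle = λ ba bc′ ac′ → no-triangle G ba ac′ bc′
  ; unique-a = unique-b G ; unique-b = unique-a G
  ; unique-c = λ p q r s → unique-c G q p s r }

swapAC : ∀ {n₁ n₂ n₃} → Graph n₁ n₂ n₃ → Graph n₃ n₂ n₁
swapAC G = record
  { ab = flip (bc G) ; ac = flip (ac G) ; bc = flip (ab G)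
  ; no-triangle = λ cb ca ba → no-triangle G ba ca cb
  ; unique-a = λ p q r s → unique-c G q p s r
  ; unique-b = λ p q r s → unique-b G q p s r
  ; unique-c = λ p q r s → unique-a G q p s r }

edges-swapAB : ∀ {n₁ n₂ n₃} (G : Graph n₁ n₂ n₃) → edges (swapAB G) ≡ edges G
edges-swapAB G
  rewrite ∑-comm (λ b a → 𝟙 (ab G a b)) =
  arith (sum (A→B G)) (sum (B→C G)) (sum (A→C G))
  where
  arith : ∀ x y z → x + y + z ≡ x + z + y
  arith = solve-∀

edges-swapAC : ∀ {n₁ n₂ n₃} (G : Graph n₁ n₂ n₃) → edges (swapAC G) ≡ edges G
edges-swapAC G
  rewrite ∑-comm (λ b a → 𝟙 (ab G a b)) | ∑-comm (λ c a → 𝟙 (ac G a c)) | ∑-comm (λ c b → 𝟙 (bc G b c)) =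
  arith (sum (B→C G)) (sum (A→C G)) (sum (A→B G))
  where
  arith : ∀ x y z → x + y + z ≡ z + y + x
  arith = solve-∀

deleteA : ∀ {n₁ n₂ n₃} → Fin (suc n₁) → Graph (suc n₁) n₂ n₃ → Graph n₁ n₂ n₃
deleteA a G = record
  { ab = ab G ∘ punchIn a ; ac = ac G ∘ punchIn a ; bc = bc G
  ; no-triangle = no-triangle G
  ; unique-a = λ p q r s → punchIn-injective a _ _ (unique-a G p q r s)
  ; unique-b = unique-b G ; unique-c = unique-c G }

deleteB : ∀ {n₁ n₂ n₃} → Fin (suc n₂) → Graph n₁ (suc n₂) n₃ → Graph n₁ n₂ n₃
deleteB b = swapAB ∘ deleteA b ∘ swapAB

deleteC : ∀ {n₁ n₂ n₃} → Fin (suc n₃) → Graph n₁ n₂ (suc n₃) → Graph n₁ n₂ n₃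
deleteC c = swapAC ∘ deleteA c ∘ swapAC

edges-deleteA : ∀ {n₁ n₂ n₃} (G : Graph (suc n₁) n₂ n₃) a →
  edges G ≡ A→B G a + A→C G a + edges (deleteA a G)
edges-deleteA G a
  rewrite sum-remove {i = a} (A→B G) | sum-remove {i = a} (A→C G) =
  arith (A→B G a) (A→C G a) _ _ _
  where
  arith : ∀ u v x y z → u + x + (v + y) + z ≡ u + v + (x + y + z)
  arith = solve-∀

edges-deleteB : ∀ {n₁ n₂ n₃} (G : Graph n₁ (suc n₂) n₃) b →
  edges G ≡ B→A G b + B→C G b + edges (deleteB b G)
edges-deleteB G b = trans (sym (edges-swapAB G)) (trans (edges-deleteA (swapAB G) b)
  (cong (B→A G b + B→C G b +_) (sym (edges-swapAB (deleteA b (swapAB G))))))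

edges-deleteC : ∀ {n₁ n₂ n₃} (G : Graph n₁ n₂ (suc n₃)) c →
  edges G ≡ C→B G c + C→A G c + edges (deleteC c G)
edges-deleteC G c = trans (sym (edges-swapAC G)) (trans (edges-deleteA (swapAC G) c)
  (cong (C→B G c + C→A G c +_) (sym (edges-swapAC (deleteA c (swapAC G))))))

-- Degree inequalities.

rectangles : ∀ {n₁ n₂ n₃} (G : Graph n₁ n₂ n₃) →
  sum (λ a → A→B G a * A→C G a) + sum (B→C G) ≤ n₂ * n₃
rectangles {n₁} {n₂} {n₃} G = begin
  sum (λ a → A→B G a * A→C G a) + sum (B→C G)
    ≡⟨ cong (_+ sum (B→C G)) (trans (sum-cong-≗ λ a → sum-product (λ b → 𝟙 (ab G a b)) (λ c → 𝟙 (ac G a c)))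
         (∑-comm λ a b → sum λ c → 𝟙 (ab G a b) * 𝟙 (ac G a c))) ⟩
  sum (λ b → sum λ a → sum λ c → 𝟙 (ab G a b) * 𝟙 (ac G a c)) + sum (B→C G)
    ≤⟨ sum-+-≤ _ (B→C G) n₃ row ⟩
  n₂ * n₃ ∎
  where
  open ≤-Reasoning
  -- For fixed b, each c has at most one common neighbour with b in A, and none if b ~ c.
  row : ∀ b → sum (λ a → sum λ c → 𝟙 (ab G a b) * 𝟙 (ac G a c)) + B→C G b ≤ n₃
  row b = begin
    sum (λ a → sum λ c → 𝟙 (ab G a b) * 𝟙 (ac G a c)) + B→C G b
      ≡⟨ cong (_+ B→C G b) (∑-comm λ a c → 𝟙 (ab G a b) * 𝟙 (ac G a c)) ⟩
    sum (λ c → sum λ a → 𝟙 (ab G a b) * 𝟙 (ac G a c)) + B→C G b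
      ≤⟨ sum-+-≤ _ _ 1 (λ c → ≤-trans
           (≤-reflexive (cong (_+ 𝟙 (bc G b c)) (sum-cong-≗ λ a → sym (𝟙-∧ (ab G a b) (ac G a c)))))
           (sum-𝟙-unique-or (λ a → ab G a b ∧ ac G a c) (bc G b c)
             (λ a a′ p q → unique-a G (proj₁ (∧-true p)) (proj₂ (∧-true p)) (proj₁ (∧-true q)) (proj₂ (∧-true q)))
             (λ r a p → no-triangle G (proj₁ (∧-true p)) (proj₂ (∧-true p)) r))) ⟩
    n₃ * 1
      ≡⟨ *-identityʳ n₃ ⟩
    n₃ ∎

-- This is (x - 1)(y - 1) ≥ 0.
x+y≤xy+1 : ∀ {x y} → 1 ≤ x → 1 ≤ y → x + y ≤ x * y + 1
x+y≤xy+1 {suc x} {suc y} _ _ = ≤-trans (m≤m+n _ (x * y)) (≤-reflexive (arith x y))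
  where
  arith : ∀ x y → suc x + suc y + x * y ≡ suc x * suc y + 1
  arith = solve-∀

-- If there were no such a, every rectangle N_B(a) × N_C(a) would have at least n₂ cells.
low-degree : ∀ {n₁ n₂ n₃} (G : Graph n₁ n₂ n₃) → n₃ < n₁ → n₃ ≤ n₂ →
  ∃[ a ] A→B G a + A→C G a ≤ n₂
low-degree {n₁} {n₂} {n₃} G n₃<n₁ n₃≤n₂ with any? (λ a → A→B G a + A→C G a ≤? n₂)
... | yes found = found
... | no none = contradiction n₁≤n₃ (<⇒≱ n₃<n₁)
  where
  open ≤-Reasoning
  high : ∀ a → n₂ < A→B G a + A→C G a
  high a = ≰⇒> (λ p → none (a , p))
  -- Neither `A→B G a` nor `A→C G a` alone exceeds n₂, so a degree above n₂ makes both positive and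
  -- `x+y≤xy+1` applies.
  big : ∀ a → n₂ ≤ A→B G a * A→C G a
  big a = s≤s⁻¹ (≤-trans (high a) (≤-trans (x+y≤xy+1
      (+-cancelʳ-< (A→C G a) 0 (A→B G a) (≤-<-trans (≤-trans (A→C≤ G a) n₃≤n₂) (high a)))
      (+-cancelˡ-< (A→B G a) 0 (A→C G a) (≤-<-trans (≤-reflexive (+-identityʳ _)) (≤-<-trans (A→B≤ G a) (high a)))))
    (≤-reflexive (+-comm _ 1))))
  n₁n₂≤n₃n₂ : n₁ * n₂ ≤ n₃ * n₂
  n₁n₂≤n₃n₂ = begin
    n₁ * n₂                                      ≤⟨ sum-≥-const n₂ big ⟩
    sum (λ a → A→B G a * A→C G a)                ≤⟨ m≤m+n _ _ ⟩
    sum (λ a → A→B G a * A→C G a) + sum (B→C G)  ≤⟨ rectangles G ⟩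
    n₂ * n₃                                      ≡⟨ *-comm n₂ n₃ ⟩
    n₃ * n₂                                      ∎
  -- Needed to cancel n₂. If n₂ = 0, then n₃ = 0 and all degrees in A vanish, against `high` at
  -- `a₀`, which exists because n₃ < n₁.
  0<n₂ : 0 < n₂
  0<n₂ = n≢0⇒n>0 λ n₂≡0 → contradiction
    (subst (_< A→B G a₀ + A→C G a₀) n₂≡0 (high a₀))
    (≤⇒≯ (+-mono-≤ (≤-trans (A→B≤ G a₀) (≤-reflexive n₂≡0)) (≤-trans (A→C≤ G a₀) (≤-trans n₃≤n₂ (≤-reflexive n₂≡0)))))
    where a₀ = fromℕ< n₃<n₁
  n₁≤n₃ : n₁ ≤ n₃
  n₁≤n₃ = *-cancelʳ-≤ n₁ n₃ n₂ {{>-nonZero 0<n₂}} n₁n₂≤n₃n₂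

two-sided : ∀ {n₁ n₂ n₃} (G : Graph n₁ n₂ n₃) → (∀ a → 1 ≤ A→B G a) → (∀ a → 1 ≤ A→C G a) →
  edges G ≤ n₂ * n₃ + n₁
two-sided {n₁} {n₂} {n₃} G toB toC = begin
  sum (A→B G) + sum (A→C G) + sum (B→C G)
    ≡⟨ cong (_+ sum (B→C G)) (sym (∑-distrib-+ (A→B G) (A→C G))) ⟩
  sum (λ a → A→B G a + A→C G a) + sum (B→C G)
    ≤⟨ +-monoˡ-≤ _ (sum-mono λ a → x+y≤xy+1 (toB a) (toC a)) ⟩
  sum (λ a → A→B G a * A→C G a + 1) + sum (B→C G)
    ≡⟨ cong (_+ sum (B→C G)) (∑-distrib-+ (λ a → A→B G a * A→C G a) (λ _ → 1)) ⟩
  sum (λ a → A→B G a * A→C G a) + sum {n₁} (λ _ → 1) + sum (B→C G)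
    ≡⟨ arith (sum λ a → A→B G a * A→C G a) (sum {n₁} λ _ → 1) (sum (B→C G)) ⟩
  sum (λ a → A→B G a * A→C G a) + sum (B→C G) + sum {n₁} (λ _ → 1)
    ≤⟨ +-mono-≤ (rectangles G) (sum-𝟙-≤ {n₁} (λ _ → true)) ⟩
  n₂ * n₃ + n₁ ∎
  where
  open ≤-Reasoning
  arith : ∀ x y z → x + y + z ≡ x + z + y
  arith = solve-∀

-- With all parts of size N the left alternative is the target bound; the right one supplies the
-- vertex from which the deletion argument starts.
one-sided : ∀ {n₁ n₂ n₃} (G : Graph n₁ n₂ n₃) →
  edges G ≤ n₂ * n₃ + n₁ ⊎ ∃[ a ] (A→B G a ≡ 0 ⊎ A→C G a ≡ 0)
one-sided G with any? (λ a → A→B G a ≟ 0) | any? (λ a → A→C G a ≟ 0)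
... | yes (a , p) | _           = inj₂ (a , inj₁ p)
... | no _        | yes (a , p) = inj₂ (a , inj₂ p)
... | no p        | no q        = inj₁ (two-sided G (λ a → n≢0⇒n>0 λ z → p (a , z)) (λ a → n≢0⇒n>0 λ z → q (a , z)))

-- N_A(b) and N_A(c) share at most one vertex, as two would give a multipartite 4-cycle.
B→A+C→A≤ : ∀ {n₁ n₂ n₃} (G : Graph n₁ n₂ n₃) b c → B→A G b + C→A G c ≤ n₁ + 1
B→A+C→A≤ {n₁} G b c = begin
  B→A G b + C→A G c
    ≡⟨ sym (∑-distrib-+ (λ a → 𝟙 (ab G a b)) (λ a → 𝟙 (ac G a c))) ⟩
  sum (λ a → 𝟙 (ab G a b) + 𝟙 (ac G a c))
    ≤⟨ sum-mono (λ a → 𝟙-inclusion-exclusion (ab G a b) (ac G a c)) ⟩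
  sum (λ a → 1 + 𝟙 (ab G a b ∧ ac G a c))
    ≡⟨ ∑-distrib-+ (λ _ → 1) (λ a → 𝟙 (ab G a b ∧ ac G a c)) ⟩
  sum {n₁} (λ _ → 1) + sum (λ a → 𝟙 (ab G a b ∧ ac G a c))
    ≤⟨ +-mono-≤ (sum-𝟙-≤ {n₁} (λ _ → true)) (sum-𝟙-unique (λ a → ab G a b ∧ ac G a c)
         (λ a a′ p q → unique-a G (proj₁ (∧-true p)) (proj₂ (∧-true p)) (proj₁ (∧-true q)) (proj₂ (∧-true q)))) ⟩
  n₁ + 1 ∎
  where open ≤-Reasoning

-- The sets N_C(b), for b ∈ N_B(a), are pairwise disjoint and avoid N_C(a).
disjoint-neighbourhoods : ∀ {n₁ n₂ n₃} (G : Graph n₁ n₂ n₃) a →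
  sum (λ b → 𝟙 (ab G a b) * B→C G b) + A→C G a ≤ n₃
disjoint-neighbourhoods {n₁} {n₂} {n₃} G a = begin
  sum (λ b → 𝟙 (ab G a b) * B→C G b) + A→C G a
    ≡⟨ cong (_+ A→C G a) (trans (sum-cong-≗ λ b → *-distribˡ-sum (𝟙 (ab G a b)) (λ c → 𝟙 (bc G b c)))
         (∑-comm λ b c → 𝟙 (ab G a b) * 𝟙 (bc G b c))) ⟩
  sum (λ c → sum λ b → 𝟙 (ab G a b) * 𝟙 (bc G b c)) + A→C G a
    ≤⟨ sum-+-≤ _ _ 1 (λ c → ≤-trans
         (≤-reflexive (cong (_+ 𝟙 (ac G a c)) (sum-cong-≗ λ b → sym (𝟙-∧ (ab G a b) (bc G b c)))))
         (sum-𝟙-unique-or (λ b → ab G a b ∧ bc G b c) (ac G a c)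
           (λ b b′ p q → unique-b G (proj₁ (∧-true p)) (proj₂ (∧-true p)) (proj₁ (∧-true q)) (proj₂ (∧-true q)))
           (λ r b p → no-triangle G (proj₁ (∧-true p)) r (proj₂ (∧-true p))))) ⟩
  n₃ * 1
    ≡⟨ *-identityʳ n₃ ⟩
  n₃ ∎
  where open ≤-Reasoning

-- If every b in N_B(a) failed, the sets N_C(b) would be too large to fit into C disjointly beside
-- N_C(a). The two alternatives lead to deleting {b, c} and {a, b, c}.
neighbour-of-small-degree : ∀ {n₁ n₂ n₃} (G : Graph n₁ n₂ n₃) a → 1 ≤ A→B G a →
  ∃[ b ] (ab G a b ≡ true × (B→C G b ≡ 0 ⊎ A→B G a + A→C G a + B→C G b ≤ n₃ + 1))
neighbour-of-small-degree {n₁} {n₂} {n₃} G a 1≤β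
  with any? (λ b → ab G a b Bool.≟ true ×-dec (B→C G b ≟ 0 ⊎-dec A→B G a + A→C G a + B→C G b ≤? n₃ + 1))
... | yes found = found
... | no none = contradiction (impossible (A→B G a) s 1≤β) (<⇒≱ too-many)
  where
  open ≤-Reasoning
  average : ∀ k → (∀ b → ab G a b ≡ true → k ≤ B→C G b) → A→B G a * k + A→C G a ≤ n₃
  average k k≤ = begin
    A→B G a * k + A→C G a                              ≡⟨ cong (_+ A→C G a) (*-distribʳ-sum k (λ b → 𝟙 (ab G a b))) ⟩
    sum (λ b → 𝟙 (ab G a b) * k) + A→C G a             ≤⟨ +-monoˡ-≤ _ (sum-mono weigh) ⟩
    sum (λ b → 𝟙 (ab G a b) * B→C G b) + A→C G a       ≤⟨ disjoint-neighbourhoods G a ⟩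
    n₃                                                 ∎
    where
    weigh : ∀ b → 𝟙 (ab G a b) * k ≤ 𝟙 (ab G a b) * B→C G b
    weigh b with ab G a b in eq
    ... | true  = *-monoʳ-≤ 1 (k≤ b eq)
    ... | false = z≤n
  -- Averaging with `k = 1`, all N_C(b) being nonempty, makes the truncated subtraction in `s`
  -- exact.
  β+γ≤n₃ : A→B G a + A→C G a ≤ n₃
  β+γ≤n₃ = subst (λ β → β + A→C G a ≤ n₃) (*-identityʳ (A→B G a))
    (average 1 λ b p → n≢0⇒n>0 λ z → none (b , p , inj₁ z))
  s = n₃ ∸ (A→B G a + A→C G a)
  n₃≡ : A→B G a + A→C G a + s ≡ n₃
  n₃≡ = m+[n∸m]≡n β+γ≤n₃
  large : ∀ b → ab G a b ≡ true → s + 2 ≤ B→C G b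
  large b p = +-cancelˡ-≤ (A→B G a + A→C G a) _ _ (begin
    A→B G a + A→C G a + (s + 2)    ≡⟨ sym (+-assoc (A→B G a + A→C G a) s 2) ⟩
    A→B G a + A→C G a + s + 2      ≡⟨ cong (_+ 2) n₃≡ ⟩
    n₃ + 2                         ≡⟨ +-suc n₃ 1 ⟩
    suc (n₃ + 1)                   ≤⟨ ≰⇒> (λ q → none (b , p , inj₂ q)) ⟩
    A→B G a + A→C G a + B→C G b    ∎)
  -- The two sides differ by (β - 1)(s + 1).
  impossible : ∀ β s → 1 ≤ β → β + s + 1 ≤ β * (s + 2)
  impossible (suc β) s _ = ≤-trans (m≤m+n _ (β * (s + 1))) (≤-reflexive (arith β s))
    where
    arith : ∀ β s → suc β + s + 1 + β * (s + 1) ≡ suc β * (s + 2)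
    arith = solve-∀
  too-many : A→B G a * (s + 2) < A→B G a + s + 1
  too-many = ≤-trans (s≤s (+-cancelʳ-≤ (A→C G a) _ _ (begin
    A→B G a * (s + 2) + A→C G a    ≤⟨ average (s + 2) large ⟩
    n₃                             ≡⟨ sym n₃≡ ⟩
    A→B G a + A→C G a + s          ≡⟨ arith (A→B G a) (A→C G a) s ⟩
    A→B G a + s + A→C G a          ∎))) (≤-reflexive (+-comm 1 (A→B G a + s)))
    where
    arith : ∀ x y z → x + y + z ≡ x + z + y
    arith = solve-∀

-- The balanced case n₁ = n₂ = n₃.

module Balanced (n : ℕ) (smaller : ∀ {n₁ n₂} → n ≤ n₁ → n ≤ n₂ → Bound n₁ n₂ n (n₁ * n₂ + n)) where

  N : ℕ
  N = suc n

  -- Parts of sizes N, N, n remain, where `smaller` gives N² + n, one below the target. Such unequal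
  -- sizes are why `smaller` ranges over all n₁, n₂ ≥ n.
  drop-C : (G : Graph N N N) → ∀ c → C→B G c + C→A G c ≤ 1 → edges G ≤ N * N + N
  drop-C G c deg≤ = begin
    edges G                                        ≡⟨ edges-deleteC G c ⟩
    C→B G c + C→A G c + edges (deleteC c G)        ≤⟨ +-mono-≤ deg≤ (smaller (n≤1+n n) (n≤1+n n) (deleteC c G)) ⟩
    1 + (N * N + n)                                ≡⟨ sym (+-suc (N * N) n) ⟩
    N * N + N                                      ∎
    where open ≤-Reasoning

  C→B-deleteB : (G : Graph N N N) → ∀ b c → C→B G c ≡ 𝟙 (bc G b c) + C→B (deleteB b G) c
  C→B-deleteB G b c = sum-remove {i = b} (λ b → 𝟙 (bc G b c))

  -- Parts of sizes N, n, n remain, and N² + N exceeds Nn + n by N + 1.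
  drop-BC : (G : Graph N N N) → ∀ b c → B→A G b + B→C G b + (C→B G c + C→A G c) ≤ N + 1 → edges G ≤ N * N + N
  drop-BC G b c deg≤ = begin
    edges G
      ≡⟨ edges-deleteB G b ⟩
    B→A G b + B→C G b + edges G₁
      ≡⟨ cong (B→A G b + B→C G b +_) (edges-deleteC G₁ c) ⟩
    B→A G b + B→C G b + (C→B G₁ c + C→A G c + edges G₂)
      ≤⟨ +-monoʳ-≤ (B→A G b + B→C G b) (+-mono-≤
           (+-monoˡ-≤ (C→A G c) (m+n≤o⇒n≤o (𝟙 (bc G b c)) (≤-reflexive (sym (C→B-deleteB G b c)))))
           (smaller (n≤1+n n) ≤-refl G₂)) ⟩
    B→A G b + B→C G b + (C→B G c + C→A G c + (N * n + n))
      ≡⟨ sym (+-assoc (B→A G b + B→C G b) _ _) ⟩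
    B→A G b + B→C G b + (C→B G c + C→A G c) + (N * n + n)
      ≤⟨ +-monoˡ-≤ _ deg≤ ⟩
    N + 1 + (N * n + n)
      ≡⟨ arith n ⟩
    N * N + N ∎
    where
    open ≤-Reasoning
    G₁ = deleteB b G
    G₂ = deleteC c G₁
    arith : ∀ n → suc n + 1 + (suc n * n + n) ≡ suc n * suc n + suc n
    arith = solve-∀

  -- N² + N exceeds n² + n by 2N. The degree sum counts the edges ab and ac twice, so the hypothesis
  -- grants them as a surplus, which is added to both sides and cancelled.
  drop-ABC : (G : Graph N N N) → ∀ a b c →
    A→B G a + A→C G a + (B→A G b + B→C G b) + (C→B G c + C→A G c) ≤ N + N + (𝟙 (ab G a b) + 𝟙 (ac G a c)) →
    edges G ≤ N * N + N
  drop-ABC G a b c deg≤ = +-cancelʳ-≤ (𝟙 (ab G a b) + 𝟙 (ac G a c)) _ _ (begin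
    edges G + (u + v)
      ≡⟨ cong (_+ (u + v)) (trans (edges-deleteB G b) (cong (B→A G b + B→C G b +_)
           (trans (edges-deleteC G₁ c) (cong (C→B G₁ c + C→A G c +_) (edges-deleteA G₂ a))))) ⟩
    B→A G b + B→C G b + (C→B G₁ c + C→A G c + (A→B G₂ a + A→C G₂ a + edges G₃)) + (u + v)
      ≤⟨ +-monoˡ-≤ (u + v) (+-monoʳ-≤ (B→A G b + B→C G b) (+-mono-≤
           (+-monoˡ-≤ (C→A G c) (m+n≤o⇒n≤o (𝟙 (bc G b c)) (≤-reflexive (sym (C→B-deleteB G b c)))))
           (+-monoʳ-≤ (A→B G₂ a + A→C G₂ a) (smaller ≤-refl ≤-refl G₃)))) ⟩
    B→A G b + B→C G b + (C→B G c + C→A G c + (A→B G₂ a + A→C G₂ a + (n * n + n))) + (u + v)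
      ≡⟨ arith₁ (B→A G b + B→C G b) (C→B G c + C→A G c) (A→B G₂ a) (A→C G₂ a) (n * n + n) u v ⟩
    (u + A→B G₂ a) + (v + A→C G₂ a) + (B→A G b + B→C G b) + (C→B G c + C→A G c) + (n * n + n)
      ≡⟨ cong₂ (λ x y → x + y + (B→A G b + B→C G b) + (C→B G c + C→A G c) + (n * n + n))
           (sym (sum-remove {i = b} (λ b → 𝟙 (ab G a b)))) (sym (sum-remove {i = c} (λ c → 𝟙 (ac G a c)))) ⟩
    A→B G a + A→C G a + (B→A G b + B→C G b) + (C→B G c + C→A G c) + (n * n + n)
      ≤⟨ +-monoˡ-≤ _ deg≤ ⟩
    N + N + (u + v) + (n * n + n)
      ≡⟨ arith₂ n (u + v) ⟩
    N * N + N + (u + v) ∎)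
    where
    open ≤-Reasoning
    u = 𝟙 (ab G a b)
    v = 𝟙 (ac G a c)
    G₁ = deleteB b G
    G₂ = deleteC c G₁
    G₃ = deleteA a G₂
    arith₁ : ∀ x y p q z u v → x + (y + (p + q + z)) + (u + v) ≡ (u + p) + (v + q) + x + y + z
    arith₁ = solve-∀
    arith₂ : ∀ n w → suc n + suc n + w + (n * n + n) ≡ suc n * suc n + suc n + w
    arith₂ = solve-∀

  path : (G : Graph N N N) → ∀ a c → C→B G c ≡ 0 → ac G a c ≡ true → 1 ≤ A→B G a → edges G ≤ N * N + N
  path G a c c↛B a~c 1≤β with neighbour-of-small-degree G a 1≤β
  -- Both b and c have neighbours in A only, so their degrees sum to at most N + 1.
  ... | b , a~b , inj₁ b↛C = drop-BC G b c
          (subst (_≤ N + 1) (sym (cong₂ (λ x y → B→A G b + x + (y + C→A G c)) b↛C c↛B))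
            (subst (λ x → x + C→A G c ≤ N + 1) (sym (+-identityʳ (B→A G b))) (B→A+C→A≤ G b c)))
  -- The total 2N + 2 is admissible because ab and ac are both edges.
  ... | b , a~b , inj₂ small = drop-ABC G a b c (begin
    A→B G a + A→C G a + (B→A G b + B→C G b) + (C→B G c + C→A G c)
      ≡⟨ cong (λ x → A→B G a + A→C G a + (B→A G b + B→C G b) + (x + C→A G c)) c↛B ⟩
    A→B G a + A→C G a + (B→A G b + B→C G b) + C→A G c
      ≡⟨ arith (A→B G a + A→C G a) (B→A G b) (B→C G b) (C→A G c) ⟩
    (A→B G a + A→C G a + B→C G b) + (B→A G b + C→A G c)
      ≤⟨ +-mono-≤ small (B→A+C→A≤ G b c) ⟩
    (N + 1) + (N + 1)
      ≡⟨ arith′ N ⟩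
    N + N + (1 + 1)
      ≡⟨ cong₂ (λ x y → N + N + (𝟙 x + 𝟙 y)) (sym a~b) (sym a~c) ⟩
    N + N + (𝟙 (ab G a b) + 𝟙 (ac G a c)) ∎)
    where
    open ≤-Reasoning
    arith : ∀ x y z w → x + (y + z) + w ≡ (x + z) + (y + w)
    arith = solve-∀
    arith′ : ∀ n → (n + 1) + (n + 1) ≡ n + n + (1 + 1)
    arith′ = solve-∀

  C-one-sided : (G : Graph N N N) → ∀ c → C→B G c ≡ 0 → edges G ≤ N * N + N
  C-one-sided G c c↛B with any? (λ a → ac G a c Bool.≟ true)
  ... | no isolated = drop-C G c (≤-trans
          (≤-reflexive (cong₂ _+_ c↛B (sum-𝟙-none (λ a → ac G a c) (λ a p → isolated (a , p))))) z≤n)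
  ... | yes (a , a~c)
    with any? (λ a′ → ac G a′ c Bool.≟ true ×-dec 1 ≤? A→B G a′)
       | any? (λ c′ → ac G a c′ Bool.≟ true ×-dec 1 ≤? C→B G c′)
       | 1 ≤? A→B G a
       | one-sided (swapAB G)
  ... | yes (a′ , a′~c , p) | _ | _ | _ = path G a′ c c↛B a′~c p
  ... | no _ | _ | yes p | _ = path G a c c↛B a~c p
  -- Here a has no neighbour in B but c′ has one: after exchanging A and C, a plays the role of c
  -- and c′ that of a.
  ... | no _ | yes (c′ , a~c′ , p) | no q | _ =
    subst (_≤ N * N + N) (edges-swapAC G) (path (swapAC G) c′ a (n<1⇒n≡0 (≰⇒> q)) a~c′ p)
  ... | no _ | no _ | no _ | inj₁ done = subst (_≤ N * N + N) (edges-swapAB G) done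
  -- No neighbour of c has a neighbour in B, so N_A(b) and N_A(c) are disjoint and have at most N
  -- elements together; a has neighbours in C only.
  ... | no none | no _ | no q | inj₂ (b , inj₂ b↛C) = drop-ABC G a b c (begin
    A→B G a + A→C G a + (B→A G b + B→C G b) + (C→B G c + C→A G c)
      ≡⟨ zeros ⟩
    A→C G a + (B→A G b + C→A G c)
      ≤⟨ +-mono-≤ (A→C≤ G a) (≤-trans (sum-+-≤ (λ a → 𝟙 (ab G a b)) (λ a → 𝟙 (ac G a c)) 1 excl) (≤-reflexive (*-identityʳ N))) ⟩
    N + N
      ≤⟨ m≤m+n _ _ ⟩
    N + N + (𝟙 (ab G a b) + 𝟙 (ac G a c)) ∎)
    where
    open ≤-Reasoning
    zeros : A→B G a + A→C G a + (B→A G b + B→C G b) + (C→B G c + C→A G c) ≡ A→C G a + (B→A G b + C→A G c)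
    zeros rewrite n<1⇒n≡0 (≰⇒> q) | b↛C | c↛B | +-identityʳ (B→A G b) = +-assoc (A→C G a) (B→A G b) (C→A G c)
    excl : ∀ a → 𝟙 (ab G a b) + 𝟙 (ac G a c) ≤ 1
    excl a′ = 𝟙-exclusive (ab G a′ b) (ac G a′ c) λ a′~c →
      sum-𝟙-zero (ab G a′) (n<1⇒n≡0 (≰⇒> λ p → none (a′ , a′~c , p))) b
  -- No neighbour of a in C has a neighbour in B, so N_C(b) and N_C(a) are disjoint and have at most
  -- N elements together; c has neighbours in A only.
  ... | no _ | no none | no q | inj₂ (b , inj₁ b↛A) = drop-ABC G a b c (begin
    A→B G a + A→C G a + (B→A G b + B→C G b) + (C→B G c + C→A G c)
      ≡⟨ zeros ⟩
    B→C G b + A→C G a + C→A G c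
      ≤⟨ +-mono-≤ (≤-trans (sum-+-≤ (λ c → 𝟙 (bc G b c)) (λ c → 𝟙 (ac G a c)) 1 excl) (≤-reflexive (*-identityʳ N))) (sum-𝟙-≤ (λ a → ac G a c)) ⟩
    N + N
      ≤⟨ m≤m+n _ _ ⟩
    N + N + (𝟙 (ab G a b) + 𝟙 (ac G a c)) ∎)
    where
    open ≤-Reasoning
    zeros : A→B G a + A→C G a + (B→A G b + B→C G b) + (C→B G c + C→A G c) ≡ B→C G b + A→C G a + C→A G c
    zeros rewrite n<1⇒n≡0 (≰⇒> q) | b↛A | c↛B = cong (_+ C→A G c) (+-comm (A→C G a) (B→C G b))
    excl : ∀ c → 𝟙 (bc G b c) + 𝟙 (ac G a c) ≤ 1
    excl c′ = 𝟙-exclusive (bc G b c′) (ac G a c′) λ a~c′ →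
      sum-𝟙-zero (λ b → bc G b c′) (n<1⇒n≡0 (≰⇒> λ p → none (c′ , a~c′ , p))) b

  balanced : Bound N N N (N * N + N)
  balanced G with one-sided (swapAC G)
  ... | inj₁ done = subst (_≤ N * N + N) (edges-swapAC G) done
  ... | inj₂ (c , inj₁ c↛B) = C-one-sided G c c↛B
  ... | inj₂ (c , inj₂ c↛A) = subst (_≤ N * N + N) (edges-swapAB G) (C-one-sided (swapAB G) c c↛A)

-- From the balanced case to arbitrary part sizes.

enlargeA : ∀ {n₁ n₂ n₃ m} → n₃ ≤ n₁ → n₃ ≤ n₂ → Bound n₁ n₂ n₃ m → Bound (suc n₁) n₂ n₃ (n₂ + m)
-- The enlarged part A is strictly larger than C, as `low-degree` demands.
enlargeA n₃≤n₁ n₃≤n₂ bound G with low-degree G (s≤s n₃≤n₁) n₃≤n₂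
... | a , deg≤ = ≤-trans (≤-reflexive (edges-deleteA G a)) (+-mono-≤ deg≤ (bound (deleteA a G)))

exchangeAB : ∀ {n₁ n₂ n₃ m} → Bound n₁ n₂ n₃ m → Bound n₂ n₁ n₃ m
exchangeAB {m = m} bound G = subst (_≤ m) (edges-swapAB G) (bound (swapAB G))

-- B grows first, with A still of size n, each vertex raising the bound by n; then A grows, each
-- vertex raising it by j + n.
enlarge : ∀ {n} → Bound n n n (n * n + n) → ∀ i j → Bound (i + n) (j + n) n ((i + n) * (j + n) + n)
enlarge {n} bound zero zero = bound
enlarge {n} bound (suc i) j =
  subst (Bound (suc i + n) (j + n) n) (sym (+-assoc (j + n) ((i + n) * (j + n)) n))
    (enlargeA (m≤n+m n i) (m≤n+m n j) (enlarge bound i j))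
enlarge {n} bound zero (suc j) =
  subst (Bound n (suc j + n) n) (arith n (j + n))
    (exchangeAB (enlargeA (m≤n+m n j) ≤-refl (exchangeAB (enlarge bound zero j))))
  where
  arith : ∀ n k → n + (n * k + n) ≡ n * suc k + n
  arith = solve-∀

-- Induction on n₃: the diagonal case n + 1 rests on the whole statement for n, and `enlarge` leads
-- from the diagonal to larger n₁ and n₂.
edges-bound : ∀ n₃ {n₁ n₂} → n₃ ≤ n₁ → n₃ ≤ n₂ → Bound n₁ n₂ n₃ (n₁ * n₂ + n₃)
edges-bound n₃ {n₁} {n₂} n₃≤n₁ n₃≤n₂ =
  subst (λ k → Bound k n₂ n₃ (k * n₂ + n₃)) (m∸n+n≡m n₃≤n₁)
    (subst (λ k → Bound (n₁ ∸ n₃ + n₃) k n₃ ((n₁ ∸ n₃ + n₃) * k + n₃)) (m∸n+n≡m n₃≤n₂)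
      (enlarge (diagonal n₃) (n₁ ∸ n₃) (n₂ ∸ n₃)))
  where
  diagonal : ∀ n → Bound n n n (n * n + n)
  diagonal zero    G = z≤n
  diagonal (suc n) = Balanced.balanced n (edges-bound n)

-- Passage from `Subgraph` to `Graph`.

count-tabulate : ∀ {X : Set} {n} (p : X → Bool) (f : Fin n → X) →
  length (filterᵇ p (tabulate f)) ≡ sum (λ i → 𝟙 (p (f i)))
count-tabulate {n = zero}  p f = refl
count-tabulate {n = suc n} p f with p (f zero)
... | true  = cong suc (count-tabulate p (f ∘ suc))
... | false = count-tabulate p (f ∘ suc)

-- As `allFin` is `tabulate id`, this turns `edgeCount` into a double sum; a general `f` lets the
-- induction pass to `f ∘ suc`.
count-product : ∀ {X Y : Set} {m n} (p : X × Y → Bool) (f : Fin m → X) (g : Fin n → Y) →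
  length (filterᵇ p (cartesianProduct (tabulate f) (tabulate g))) ≡ sum (λ i → sum (λ j → 𝟙 (p (f i , g j))))
count-product {m = zero}  p f g = refl
count-product {m = suc m} p f g = begin
  length (filterᵇ p (List.map (f zero ,_) (tabulate g) ++ rest))
    ≡⟨ cong (λ row → length (filterᵇ p (row ++ rest))) (map-tabulate g (f zero ,_)) ⟩
  length (filterᵇ p (tabulate (λ j → f zero , g j) ++ rest))
    ≡⟨ cong length (filter-++ (T? ∘ p) (tabulate (λ j → f zero , g j)) rest) ⟩
  length (filterᵇ p (tabulate (λ j → f zero , g j)) ++ filterᵇ p rest)
    ≡⟨ length-++ (filterᵇ p (tabulate (λ j → f zero , g j))) ⟩
  length (filterᵇ p (tabulate (λ j → f zero , g j))) + length (filterᵇ p rest)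
    ≡⟨ cong₂ _+_ (count-tabulate p (λ j → f zero , g j)) (count-product p (f ∘ suc) g) ⟩
  sum (λ i → sum (λ j → 𝟙 (p (f i , g j)))) ∎
  where
  open ≡-Reasoning
  rest = cartesianProduct (tabulate (f ∘ suc)) (tabulate g)

module _ {n₁ n₂ n₃ : ℕ} where

  inA : Fin n₁ → Vtx n₁ n₂ n₃
  inA a = a ↑ˡ (n₂ + n₃)

  inB : Fin n₂ → Vtx n₁ n₂ n₃
  inB b = n₁ ↑ʳ (b ↑ˡ n₃)

  inC : Fin n₃ → Vtx n₁ n₂ n₃
  inC c = n₁ ↑ʳ (n₂ ↑ʳ c)

  side : Vtx n₁ n₂ n₃ → Fin n₁ ⊎ Fin n₂ ⊎ Fin n₃
  side v = Sum.map₂ (splitAt n₂) (splitAt n₁ v)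

  side-inA : ∀ a → side (inA a) ≡ inj₁ a
  side-inA a = cong (Sum.map₂ (splitAt n₂)) (splitAt-↑ˡ n₁ a (n₂ + n₃))

  side-inB : ∀ b → side (inB b) ≡ inj₂ (inj₁ b)
  side-inB b = trans (cong (Sum.map₂ (splitAt n₂)) (splitAt-↑ʳ n₁ (n₂ + n₃) (b ↑ˡ n₃)))
    (cong inj₂ (splitAt-↑ˡ n₂ b n₃))

  side-inC : ∀ c → side (inC c) ≡ inj₂ (inj₂ c)
  side-inC c = trans (cong (Sum.map₂ (splitAt n₂)) (splitAt-↑ʳ n₁ (n₂ + n₃) (n₂ ↑ʳ c)))
    (cong inj₂ (splitAt-↑ʳ n₂ n₃ c))

  vertex : Fin n₁ ⊎ Fin n₂ ⊎ Fin n₃ → Vtx n₁ n₂ n₃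
  vertex (inj₁ a)        = inA a
  vertex (inj₂ (inj₁ b)) = inB b
  vertex (inj₂ (inj₂ c)) = inC c

  vertex-side : ∀ v → vertex (side v) ≡ v
  vertex-side v with splitAt n₁ v in eq₁
  ... | inj₁ a = splitAt⁻¹-↑ˡ eq₁
  ... | inj₂ w with splitAt n₂ w in eq₂
  ...   | inj₁ b = trans (cong (n₁ ↑ʳ_) (splitAt⁻¹-↑ˡ eq₂)) (splitAt⁻¹-↑ʳ eq₁)
  ...   | inj₂ c = trans (cong (n₁ ↑ʳ_) (splitAt⁻¹-↑ʳ eq₂)) (splitAt⁻¹-↑ʳ eq₁)

  side-injective : ∀ u v → side u ≡ side v → u ≡ v
  side-injective u v eq = trans (sym (vertex-side u)) (trans (cong vertex eq) (vertex-side v))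

  partOf : Fin n₁ ⊎ Fin n₂ ⊎ Fin n₃ → Fin 3
  partOf (inj₁ _)        = zero
  partOf (inj₂ (inj₁ _)) = suc zero
  partOf (inj₂ (inj₂ _)) = suc (suc zero)

  part-side : ∀ v → part n₁ n₂ n₃ v ≡ partOf (side v)
  part-side v with splitAt n₁ v
  ... | inj₁ a = refl
  ... | inj₂ w with splitAt n₂ w
  ...   | inj₁ b = refl
  ...   | inj₂ c = refl

  part-inA : ∀ a → part n₁ n₂ n₃ (inA a) ≡ zero
  part-inA a = trans (part-side (inA a)) (cong partOf (side-inA a))

  part-inB : ∀ b → part n₁ n₂ n₃ (inB b) ≡ suc zero
  part-inB b = trans (part-side (inB b)) (cong partOf (side-inB b))

  part-inC : ∀ c → part n₁ n₂ n₃ (inC c) ≡ suc (suc zero)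
  part-inC c = trans (part-side (inC c)) (cong partOf (side-inC c))

  toℕ-inB : ∀ b → toℕ (inB b) ≡ n₁ + toℕ b
  toℕ-inB b = trans (toℕ-↑ʳ n₁ (b ↑ˡ n₃)) (cong (n₁ +_) (toℕ-↑ˡ b n₃))

  toℕ-inC : ∀ c → toℕ (inC c) ≡ n₁ + (n₂ + toℕ c)
  toℕ-inC c = trans (toℕ-↑ʳ n₁ (n₂ ↑ʳ c)) (cong (n₁ +_) (toℕ-↑ʳ n₂ c))

  inA<inB : ∀ a b → toℕ (inA a) < toℕ (inB b)
  inA<inB a b rewrite toℕ-↑ˡ a (n₂ + n₃) | toℕ-inB b = <-≤-trans (toℕ<n a) (m≤m+n n₁ _)

  inA<inC : ∀ a c → toℕ (inA a) < toℕ (inC c)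
  inA<inC a c rewrite toℕ-↑ˡ a (n₂ + n₃) | toℕ-inC c = <-≤-trans (toℕ<n a) (m≤m+n n₁ _)

  inB<inC : ∀ b c → toℕ (inB b) < toℕ (inC c)
  inB<inC b c rewrite toℕ-inB b | toℕ-inC c = +-monoʳ-< n₁ (<-≤-trans (toℕ<n b) (m≤m+n n₂ _))

  module _ (H : Subgraph n₁ n₂ n₃) where

    edge : Vtx n₁ n₂ n₃ → Vtx n₁ n₂ n₃ → ℕ
    edge u v = 𝟙 ((toℕ u <ᵇ toℕ v) ∧ adj H u v)

    edge-forward : ∀ {u v} → toℕ u < toℕ v → edge u v ≡ 𝟙 (adj H u v)
    edge-forward {u} {v} u<v with toℕ u <ᵇ toℕ v | <⇒<ᵇ u<v
    ... | true | _ = refl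

    edge-backward : ∀ {u v} → toℕ v < toℕ u → edge u v ≡ 0
    edge-backward {u} {v} v<u with toℕ u <ᵇ toℕ v in eq
    ... | true  = contradiction (<ᵇ⇒< (toℕ u) (toℕ v) (subst T (sym eq) _)) (<-asym v<u)
    ... | false = refl

    edge-within : ∀ {u v i} → part n₁ n₂ n₃ u ≡ i → part n₁ n₂ n₃ v ≡ i → edge u v ≡ 0
    edge-within {u} {v} pu pv with toℕ u <ᵇ toℕ v | adj H u v in eq
    ... | false | _     = refl
    ... | true  | false = refl
    ... | true  | true  = contradiction (trans pu (sym pv)) (cross H u v eq)

    -- Of the nine blocks of pairs, three lie within a part and vanish by `cross`. Indices put A
    -- before B before C, so the test on `toℕ` keeps AB, AC, BC and kills their transposes.
    edgeCount-sum : edgeCount H ≡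
      sum (λ a → sum λ b → 𝟙 (adj H (inA a) (inB b))) + sum (λ a → sum λ c → 𝟙 (adj H (inA a) (inC c)))
        + sum (λ b → sum λ c → 𝟙 (adj H (inB b) (inC c)))
    edgeCount-sum = begin
      edgeCount H
        ≡⟨ count-product {m = n₁ + (n₂ + n₃)} {n = n₁ + (n₂ + n₃)} _ id id ⟩
      sum (λ u → sum (edge u))
        ≡⟨ split (λ u → sum (edge u)) ⟩
      sum (λ a → sum (edge (inA a))) + (sum (λ b → sum (edge (inB b))) + sum (λ c → sum (edge (inC c))))
        ≡⟨ cong₂ _+_ (trans (sum-cong-≗ rowA) (∑-distrib-+ (λ a → sum λ b → 𝟙 (adj H (inA a) (inB b))) (λ a → sum λ c → 𝟙 (adj H (inA a) (inC c)))))
             (trans (cong₂ _+_ (sum-cong-≗ rowB) (sum-vanish rowC)) (+-identityʳ _)) ⟩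
      _ ∎
      where
      open ≡-Reasoning
      split : (f : Vtx n₁ n₂ n₃ → ℕ) → sum f ≡ sum (f ∘ inA) + (sum (f ∘ inB) + sum (f ∘ inC))
      split f = trans (sum-split n₁ f) (cong (sum (f ∘ inA) +_) (sum-split n₂ (f ∘ (n₁ ↑ʳ_))))
      rowA : ∀ a → sum (edge (inA a)) ≡ sum (λ b → 𝟙 (adj H (inA a) (inB b))) + sum (λ c → 𝟙 (adj H (inA a) (inC c)))
      rowA a = trans (split (edge (inA a))) (cong₂ _+_ (sum-vanish λ a′ → edge-within (part-inA a) (part-inA a′))
        (cong₂ _+_ (sum-cong-≗ λ b → edge-forward (inA<inB a b)) (sum-cong-≗ λ c → edge-forward (inA<inC a c))))
      rowB : ∀ b → sum (edge (inB b)) ≡ sum (λ c → 𝟙 (adj H (inB b) (inC c)))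
      rowB b = trans (split (edge (inB b))) (cong₂ _+_ (sum-vanish λ a → edge-backward (inA<inB a b))
        (cong₂ _+_ (sum-vanish λ b′ → edge-within (part-inB b) (part-inB b′)) (sum-cong-≗ λ c → edge-forward (inB<inC b c))))
      rowC : ∀ c → sum (edge (inC c)) ≡ 0
      rowC c = trans (split (edge (inC c))) (cong₂ _+_ (sum-vanish λ a → edge-backward (inA<inC a c))
        (cong₂ _+_ (sum-vanish λ b → edge-backward (inB<inC b c)) (sum-vanish λ c′ → edge-within (part-inC c) (part-inC c′))))

    -- The cycle is x, y, x′, z. Its consecutive vertices differ because edges cross parts; the
    -- diagonals differ by assumption.
    multiC4 : ∀ {x x′ y z} → x ≢ x′ → y ≢ z →
      adj H x y ≡ true → adj H x z ≡ true → adj H x′ y ≡ true → adj H x′ z ≡ true →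
      (∀ i → part n₁ n₂ n₃ x ≡ i ⊎ part n₁ n₂ n₃ y ≡ i ⊎ part n₁ n₂ n₃ z ≡ i) → HasMultiC4 H
    multiC4 {x} {x′} {y} {z} x≢x′ y≢z xy xz x′y x′z parts =
      x , y , x′ , z ,
      (distinct xy , x≢x′ , distinct xz , distinct yx′ , y≢z , distinct x′z) ,
      (xy , yx′ , x′z , trans (Subgraph.sym H z x) xz) ,
      λ i → Sum.map₂ (Sum.map₂ inj₂) (parts i)
      where
      yx′ = trans (Subgraph.sym H y x′) x′y
      distinct : ∀ {u v} → adj H u v ≡ true → u ≢ v
      distinct {u} {v} uv u≡v = cross H u v uv (cong (part n₁ n₂ n₃) u≡v)

    parts-differ : ∀ {u v i j} → part n₁ n₂ n₃ u ≡ i → part n₁ n₂ n₃ v ≡ j → i ≢ j → u ≢ v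
    parts-differ pu pv i≢j refl = i≢j (trans (sym pu) pv)

    toGraph : Free H → Graph n₁ n₂ n₃
    toGraph (no-C3 , no-C4) = record
      { ab = λ a b → adj H (inA a) (inB b)
      ; ac = λ a c → adj H (inA a) (inC c)
      ; bc = λ b c → adj H (inB b) (inC c)
      ; no-triangle = λ {a} {b} {c} p q r → no-C3 (inA a , inB b , inC c , p , r , reverse q)
      ; unique-a = λ {b} {c} {a} {a′} p q r s → ↑ˡ-injective (n₂ + n₃) a a′ (unique λ x≢x′ →
          multiC4 x≢x′ (parts-differ (part-inB b) (part-inC c) λ ()) p q r s
            λ { zero → inj₁ (part-inA a) ; (suc zero) → inj₂ (inj₁ (part-inB b)) ; (suc (suc zero)) → inj₂ (inj₂ (part-inC c)) })
      ; unique-b = λ {a} {c} {b} {b′} p q r s → ↑ˡ-injective n₃ b b′ (↑ʳ-injective n₁ _ _ (unique λ x≢x′ →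
          multiC4 x≢x′ (parts-differ (part-inA a) (part-inC c) λ ()) (reverse p) q (reverse r) s
            λ { zero → inj₂ (inj₁ (part-inA a)) ; (suc zero) → inj₁ (part-inB b) ; (suc (suc zero)) → inj₂ (inj₂ (part-inC c)) }))
      ; unique-c = λ {a} {b} {c} {c′} p q r s → ↑ʳ-injective n₂ c c′ (↑ʳ-injective n₁ _ _ (unique λ x≢x′ →
          multiC4 x≢x′ (parts-differ (part-inA a) (part-inB b) λ ()) (reverse p) (reverse q) (reverse r) (reverse s)
            λ { zero → inj₂ (inj₁ (part-inA a)) ; (suc zero) → inj₂ (inj₂ (part-inB b)) ; (suc (suc zero)) → inj₁ (part-inC c) }))
      }
      where
      reverse : ∀ {u v} → adj H u v ≡ true → adj H v u ≡ true
      reverse {u} {v} uv = trans (Subgraph.sym H v u) uv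
      -- Decidable equality on `Fin` turns the excluded cycle into an equation.
      unique : ∀ {u v} → (u ≢ v → HasMultiC4 H) → u ≡ v
      unique {u} {v} cycle with u Fin.≟ v
      ... | yes u≡v = u≡v
      ... | no  u≢v = contradiction (cycle u≢v) no-C4

  -- The extremal graph.

  -- Complete between A and B, with every vertex of C hanging off the first vertex of A.
  joined : Fin n₁ ⊎ Fin n₂ ⊎ Fin n₃ → Fin n₁ ⊎ Fin n₂ ⊎ Fin n₃ → Bool
  joined (inj₁ a)        (inj₂ (inj₁ b)) = true
  joined (inj₁ a)        (inj₂ (inj₂ c)) = toℕ a ≡ᵇ 0
  joined (inj₂ (inj₁ b)) (inj₁ a)        = true
  joined (inj₂ (inj₂ c)) (inj₁ a)        = toℕ a ≡ᵇ 0
  joined _               _               = false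

  joined-sym : ∀ s t → joined s t ≡ joined t s
  joined-sym (inj₁ a)        (inj₁ a′)        = refl
  joined-sym (inj₁ a)        (inj₂ (inj₁ b))  = refl
  joined-sym (inj₁ a)        (inj₂ (inj₂ c))  = refl
  joined-sym (inj₂ (inj₁ b)) (inj₁ a)         = refl
  joined-sym (inj₂ (inj₁ b)) (inj₂ (inj₁ b′)) = refl
  joined-sym (inj₂ (inj₁ b)) (inj₂ (inj₂ c))  = refl
  joined-sym (inj₂ (inj₂ c)) (inj₁ a)         = refl
  joined-sym (inj₂ (inj₂ c)) (inj₂ (inj₁ b))  = refl
  joined-sym (inj₂ (inj₂ c)) (inj₂ (inj₂ c′)) = refl

  isA : Fin n₁ ⊎ Fin n₂ ⊎ Fin n₃ → Bool
  isA (inj₁ _) = true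
  isA (inj₂ _) = false

  -- Excludes triangles: around one, `isA` would flip three times and return negated.
  joined-bipartite : ∀ s t → joined s t ≡ true → isA s ≡ not (isA t)
  joined-bipartite (inj₁ a)        (inj₂ _)        _ = refl
  joined-bipartite (inj₂ _)        (inj₁ a)        _ = refl
  joined-bipartite (inj₂ (inj₁ b)) (inj₂ (inj₁ _)) ()
  joined-bipartite (inj₂ (inj₁ b)) (inj₂ (inj₂ _)) ()
  joined-bipartite (inj₂ (inj₂ c)) (inj₂ (inj₁ _)) ()
  joined-bipartite (inj₂ (inj₂ c)) (inj₂ (inj₂ _)) ()

  joined-cross : ∀ s t → joined s t ≡ true → partOf s ≢ partOf t
  joined-cross (inj₁ a)        (inj₂ (inj₁ b)) _ ()
  joined-cross (inj₁ a)        (inj₂ (inj₂ c)) _ ()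
  joined-cross (inj₂ (inj₁ b)) (inj₁ a)        _ ()
  joined-cross (inj₂ (inj₂ c)) (inj₁ a)        _ ()

  -- Excludes multipartite 4-cycles: such a cycle meets C, where a vertex can be adjacent only to
  -- the first vertex of A.
  joined-leaf : ∀ r s t → partOf r ≡ suc (suc zero) → joined r s ≡ true → joined r t ≡ true → s ≡ t
  joined-leaf (inj₂ (inj₂ c)) (inj₁ a) (inj₁ a′) _ p q =
    cong inj₁ (toℕ-injective (trans (is-zero a p) (sym (is-zero a′ q))))
    where
    is-zero : ∀ {n} (i : Fin n) → (toℕ i ≡ᵇ 0) ≡ true → toℕ i ≡ 0
    is-zero zero _ = refl
  joined-leaf (inj₂ (inj₂ c)) (inj₁ a) (inj₂ (inj₁ _)) _ _ ()
  joined-leaf (inj₂ (inj₂ c)) (inj₁ a) (inj₂ (inj₂ _)) _ _ ()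
  joined-leaf (inj₂ (inj₂ c)) (inj₂ (inj₁ _)) _ _ ()
  joined-leaf (inj₂ (inj₂ c)) (inj₂ (inj₂ _)) _ _ ()

  extremal : Subgraph n₁ n₂ n₃
  extremal = record
    { adj   = λ u v → joined (side u) (side v)
    ; sym   = λ u v → joined-sym (side u) (side v)
    ; cross = λ u v uv same → joined-cross (side u) (side v) uv (trans (sym (part-side u)) (trans same (part-side v)))
    }

  extremal-leaf : ∀ {w u v} → part n₁ n₂ n₃ w ≡ suc (suc zero) →
    adj extremal w u ≡ true → adj extremal w v ≡ true → u ≡ v
  extremal-leaf {w} {u} {v} inC wu wv =
    side-injective u v (joined-leaf (side w) (side u) (side v) (trans (sym (part-side w)) inC) wu wv)

  extremal-free : Free extremal
  extremal-free = no-C3 , no-C4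
    where
    no-C3 : ¬ HasTriangle extremal
    no-C3 (u , v , w , uv , vw , wu) = not-¬ {isA (side u)} refl
      (trans (joined-bipartite (side u) (side v) uv)
        (cong not (trans (joined-bipartite (side v) (side w) vw)
          (trans (cong not (joined-bipartite (side w) (side u) wu)) (not-involutive (isA (side u)))))))
    back : ∀ {u v} → adj extremal u v ≡ true → adj extremal v u ≡ true
    back {u} {v} uv = trans (joined-sym (side v) (side u)) uv
    no-C4 : ¬ HasMultiC4 extremal
    -- The two cycle neighbours of the vertex in C coincide, although opposite vertices are
    -- distinct.
    no-C4 (a , b , c , d , (_ , a≢c , _ , _ , b≢d , _) , (ab , bc , cd , da) , parts) with parts (suc (suc zero))
    ... | inj₁ a∈C               = b≢d (extremal-leaf a∈C ab (back {d} {a} da))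
    ... | inj₂ (inj₁ b∈C)        = a≢c (extremal-leaf b∈C (back {a} {b} ab) bc)
    ... | inj₂ (inj₂ (inj₁ c∈C)) = b≢d (extremal-leaf c∈C (back {b} {c} bc) cd)
    ... | inj₂ (inj₂ (inj₂ d∈C)) = a≢c (extremal-leaf d∈C da (back {c} {d} cd))

  -- `1 ≤ n₁` provides the first vertex of A, to which the n₃ pendant edges are attached.
  extremal-edgeCount : 1 ≤ n₁ → edgeCount extremal ≡ n₁ * n₂ + n₃
  extremal-edgeCount 1≤n₁ = begin
    edgeCount extremal
      ≡⟨ edgeCount-sum extremal ⟩
    sum {n₁} (λ a → sum {n₂} λ b → 𝟙 (joined (side (inA a)) (side (inB b))))
      + sum {n₁} (λ a → sum {n₃} λ c → 𝟙 (joined (side (inA a)) (side (inC c))))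
      + sum {n₂} (λ b → sum {n₃} λ c → 𝟙 (joined (side (inB b)) (side (inC c))))
      ≡⟨ cong₂ _+_ (cong₂ _+_
           (sum-cong-≗ {n₁} λ a → sum-cong-≗ {n₂} λ b → cong 𝟙 (cong₂ joined (side-inA a) (side-inB b)))
           (sum-cong-≗ {n₁} λ a → sum-cong-≗ {n₃} λ c → cong 𝟙 (cong₂ joined (side-inA a) (side-inC c))))
           (sum-cong-≗ {n₂} λ b → sum-cong-≗ {n₃} λ c → cong 𝟙 (cong₂ joined (side-inB b) (side-inC c))) ⟩
    sum {n₁} (λ _ → sum {n₂} λ _ → 1) + sum {n₁} (λ a → sum {n₃} λ _ → 𝟙 (toℕ a ≡ᵇ 0)) + sum {n₂} (λ _ → sum {n₃} λ _ → 0)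
      ≡⟨ cong₂ _+_ (cong₂ _+_
           (trans (sum-const n₁ _) (cong (n₁ *_) (trans (sum-const n₂ 1) (*-identityʳ n₂))))
           (sum-zero-indicator n₃ 1≤n₁))
           (sum-vanish {n₂} λ _ → sum-replicate-zero n₃) ⟩
    n₁ * n₂ + n₃ + 0
      ≡⟨ +-identityʳ (n₁ * n₂ + n₃) ⟩
    n₁ * n₂ + n₃ ∎
    where open ≡-Reasoning

theorem2 : ∀ (n₁ n₂ n₃ : ℕ) → n₁ ≥ n₂ → n₂ ≥ n₃ → n₃ ≥ 1 →
    ExEquals n₁ n₂ n₃ (n₁ * n₂ + n₃)
theorem2 n₁ n₂ n₃ n₁≥n₂ n₂≥n₃ n₃≥1 =
  (λ H free → ≤-trans (≤-reflexive (edgeCount-sum H)) (edges-bound n₃ n₃≤n₁ n₂≥n₃ (toGraph H free)))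
  , extremal {n₁} {n₂} {n₃} , extremal-free {n₁} {n₂} {n₃} , extremal-edgeCount {n₁} {n₂} {n₃} (≤-trans n₃≥1 n₃≤n₁)
  where
  n₃≤n₁ : n₃ ≤ n₁
  n₃≤n₁ = ≤-trans n₂≥n₃ n₁≥n₂
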